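{- The $(a,b)$-algorithm takes time $O(Rw^2)$ to compactly display the order ideals of a $w$-element poset as a disjoint union of $R$ many $\{0,1,2,a,b\}$-valued rows. (Here $R$ is the number of final rows which the algorithm produces.)
   Context: An order ideal of a poset $(W,\le)$ is a subset $X\subseteq W$ such that $p\in X$ and $q\le p$ imply $q\in X$. $[w]=\{1,\dots,w\}$. A set $X$ satisfies an implication $A\to B$ if $A\subseteq X$ implies $B\subseteq X$. Rows. A $\{0,1,2,a,b\}$-valued row $r$ of length $w$ is a partition of $[w]$ into four (possibly empty) parts $\mathrm{zeros}(r)$, $\mathrm{ones}(r)$, $\mathrm{twos}(r)$, $\mathrm{implications}(r)$, where $\mathrm{implications}(r)$, if nonempty, is further partitioned as $\mathrm{prem}[1]\cup\mathrm{conc}[1]\cup\dots\cup\mathrm{prem}[t]\cup\mathrm{conc}[t]$ ($t\ge1$) with all $\mathrm{prem}[i]$ singletons and all $\mathrm{conc}[i]$ nonempty. The row $r$ represents the family of all $X\subseteq[w]$ with $\mathrm{ones}(r)\subseteq X$, $\mathrm{zeros}(r)\cap X=\emptyset$, and, for all $1\le i\le t$, $\mathrm{prem}[i]\subseteq X\Rightarrow \mathrm{conc}[i]\subseteq X$. Visually, $r$ is a string of length $w$ with symbols $0,1,2$ at the positions in $\mathrm{zeros}(r),\mathrm{ones}(r),\mathrm{twos}(r)$, symbol $a_i$ at the position in $\mathrm{prem}[i]$, and symbol $b_i$ at each position in $\mathrm{conc}[i]$. The $(a,b)$-algorithm. Let $(W,\le)$ be a $w$-element poset, relabelled so that $W=[w]$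 and $1,2,\dots,w$ is a linear extension of $\le$. For $j\in W$ let $LC(j)$ be the set of lower covers of $j$. The order ideals are exactly the sets satisfying all implications $\{j\}\to LC(j)$, $j=1,\dots,w$ (for minimal $j$ the conclusion is empty). The algorithm keeps a working stack of rows, initially containing only $(2,2,\dots,2)$, and each row records which implication is pending (initially $j=1$). Repeatedly, the topmost row $r$ of the stack is taken (last in, first out) and its pending implication $\{j\}\to B$, $B=LC(j)$, is imposed on it; the resulting one or two rows replace $r$ on top of the stack with pending implication $j+1$. A row upon which all $w$ implications have been imposed is moved to the final stack; the algorithm ends when the working stack is empty. Because of the linear extension ordering, the $j$-th entry of $r$ is always $2$ when $\{j\}\to B$ is imposed. The imposition of $\{j\}\to B$ on $r$ is as follows. Case 1: $B\cap\mathrm{zeros}(r)\ne\emptyset$. The $2$ at position $j$ becomes $0$. Case 2: $B\subseteq\mathrm{ones}(r)$. Then $r$ carries over unaltered. Case 3: at least one position in $B$ carries $2$ and the others, if any, carry $1$. The $2$ at position $j$ becomes a symbol $a$ and the $2$'s at positions in $B$ become symbols $b$, with a new common index (that is, a new pair $\mathrm{prem},\mathrm{conc}$ is created). Case 4: no position in $B$ carries $0$, but some position in $B$ carries a symbol $a_i$ or $b_i$. Then $r$ is replaced by two rows $r'$ and $r''$. Row $r'$ arises from $r$ by changing the $2$ at position $j$ to $0$. Row $r''$ arises from $r$ by changing position $j$ and all positions in $B$ to $1$, and updating: whenever the position of $a_i$ became $1$, all positions of $b_i$ become $1$; whenever some positions of $b_i$ became $1$ while $a_i$ did not, those positions are removed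 from $\mathrm{conc}[i]$, and if $\mathrm{conc}[i]$ thereby becomes empty, $a_i$ becomes $2$. The rows on the final stack are the final rows. -}

module Defs where

open import Data.Bool using (Bool; true; false; if_then_else_; _∨_)
open import Data.Fin as Fin using (Fin; zero; suc; fromℕ<)
open import Data.Fin.Properties using (any?; _≟_)
open import Data.Fin.Subset using (Subset; _∈_)
open import Data.List using (List; []; _∷_)
open import Data.List.Relation.Unary.AllPairs using (AllPairs)
open import Data.List.Relation.Unary.Any using (Any)
open import Data.Nat as ℕ using (ℕ; zero; suc; _+_; _<?_)
open import Data.Product using (∃-syntax; _×_; _,_)
open import Data.Vec using (Vec; lookup; replicate; tabulate; _[_]≔_)
open import Function using (_∘_; _⇔_)
open import Level using (0ℓ)
open import Relation.Binary using (Rel; IsDecPartialOrder)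
import Relation.Binary.Construct.NonStrictToStrict as Strict
open import Relation.Binary.PropositionalEquality using (_≡_)
open import Relation.Nullary using (¬_; Dec; yes; no; does; ¬?; _×-dec_)
open import Relation.Unary using (Pred; _⊆_; _⊥_; _∪_; _≐_; ｛_｝; Satisfiable)

-- [w] is Fin w (so positions are counted from 0), and its natural order is
-- a linear extension of the partial order.
record LabelledPoset (w : ℕ) : Set₁ where
  field
    _≤_               : Rel (Fin w) 0ℓ
    isDecPartialOrder : IsDecPartialOrder _≡_ _≤_
    linearExtension   : ∀ {p q} → p ≤ q → p Fin.≤ q

  open IsDecPartialOrder isDecPartialOrder public using (_≤?_)
  open Strict _≡_ _≤_ public using (_<_)

  _<ₚ?_ : ∀ p q → Dec (p < q)
  _<ₚ?_ = Strict.<-decidable _≡_ _≤_ _≟_ _≤?_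

  _⋖_ : Rel (Fin w) 0ℓ
  p ⋖ q = p < q × ¬ (∃[ m ] (p < m × m < q))

  _⋖?_ : ∀ p q → Dec (p ⋖ q)
  p ⋖? q = (p <ₚ? q) ×-dec ¬? (any? λ m → (p <ₚ? m) ×-dec (m <ₚ? q))

  IsOrderIdeal : Pred (Subset w) 0ℓ
  IsOrderIdeal X = ∀ {p q} → p ∈ X → q ≤ p → q ∈ X

  LC : Fin w → Subset w
  LC j = tabulate λ p → does (p ⋖? j)

-- a i and b i are the symbols with index i.  There are never more than w
-- indices in a row of length w; those in use need not form an initial segment.
data Symbol (w : ℕ) : Set where
  𝟎 𝟏 𝟐 : Symbol w
  a b   : Fin w → Symbol w

Row : ℕ → Set
Row w = Vec (Symbol w) w

module _ {w : ℕ} (r : Row w) where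

  zeros ones : Pred (Fin w) 0ℓ
  zeros p = lookup r p ≡ 𝟎
  ones  p = lookup r p ≡ 𝟏

  prem conc : Fin w → Pred (Fin w) 0ℓ
  prem i p = lookup r p ≡ a i
  conc i p = lookup r p ≡ b i

  IsRow : Set
  IsRow = ∀ i → Satisfiable (prem i ∪ conc i) →
          (∃[ p ] prem i ≐ ｛ p ｝) × Satisfiable (conc i)

  ⟦_⟧ : Pred (Subset w) 0ℓ
  ⟦_⟧ X = (ones ⊆ (_∈ X))
        × (zeros ⊥ (_∈ X))
        × (∀ i → prem i ⊆ (_∈ X) → conc i ⊆ (_∈ X))

IsDisjointUnionOf : ∀ {w} → Pred (Subset w) 0ℓ → List (Row w) → Set
IsDisjointUnionOf 𝓕 rs =
    (∀ X → 𝓕 X ⇔ Any (λ r → ⟦ r ⟧ X) rs)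
  × AllPairs (λ r s → ⟦ r ⟧ ⊥ ⟦ s ⟧) rs

-- Time counts elementary operations on a random access machine: array
-- accesses, counter comparisons, stack operations and loop iterations cost 1;
-- allocating or copying an array costs its length.  Programs below touch data
-- only through these operations and otherwise just branch on a value that has
-- been read.  Arrays are used single-threadedly (a duplicate is made by `copy`
-- only), so that `write` stands for an update in place.
record Timed (A : Set) : Set where
  constructor _costs_
  field
    value : A
    time  : ℕ

open Timed public

pure : ∀ {A} → A → Timed A
pure x = x costs 0

infixl 1 _>>=_

_>>=_ : ∀ {A B} → Timed A → (A → Timed B) → Timed B
m >>= f = value (f (value m)) costs (time m + time (f (value m)))

tick : ∀ {A} → Timed A → Timed A
tick m = value m costs suc (time m)

read : ∀ {A n} → Vec A n → Fin n → Timed A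
read v i = lookup v i costs 1

write : ∀ {A n} → Vec A n → Fin n → A → Timed (Vec A n)
write v i x = (v [ i ]≔ x) costs 1

new : ∀ {A} n → A → Timed (Vec A n)
new n x = replicate n x costs n

copy : ∀ {A n} → Vec A n → Timed (Vec A n)
copy {n = n} v = v costs n

push : ∀ {A} → A → List A → Timed (List A)
push x xs = (x ∷ xs) costs 1

loop : ∀ {A n} → (Fin n → A → Timed A) → A → Timed A
loop {n = zero}  body x = pure x
loop {n = suc n} body x = tick do
  y ← body zero x
  loop (body ∘ suc) y

isZero isTwo isIndexed : ∀ {w} → Symbol w → Bool
isZero 𝟎 = true
isZero _ = false
isTwo 𝟐 = true
isTwo _ = false
isIndexed (a _) = true
isIndexed (b _) = true
isIndexed _     = false

module _ {w : ℕ} where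

  someInBody : Subset w → Row w → (Symbol w → Bool) → Fin w → Bool → Timed Bool
  someInBody B r f p found = do
    p∈B ← read B p
    if p∈B
      then (do s ← read r p
               pure (found ∨ f s))
      else pure found

  -- Does some position in B carry a symbol satisfying f?
  someIn : Subset w → Row w → (Symbol w → Bool) → Timed Bool
  someIn B r f = loop (someInBody B r f) false

  case3Body : Fin w → Subset w → Fin w → Row w → Timed (Row w)
  case3Body j B p r = do
    p∈B ← read B p
    if p∈B
      then (do s ← read r p
               if isTwo s then write r p (b j) else pure r)
      else pure r

  -- The position j serves as the new index; it is unused, since a j and b j
  -- are only ever written when {j} → LC(j) is imposed.
  case3 : Fin w → Subset w → Row w → Timed (Row w)
  case3 j B r = do
    r₁ ← loop (case3Body j B) r
    write r₁ j (a j)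

  markFired : Symbol w → Vec Bool w → Timed (Vec Bool w)
  markFired (a i) fired = write fired i true
  markFired _     fired = pure fired

  firedBody : Subset w → Row w → Fin w → Vec Bool w → Timed (Vec Bool w)
  firedBody B r p fired = do
    p∈B ← read B p
    if p∈B
      then (do s ← read r p
               markFired s fired)
      else pure fired

  -- Entry i of the result: the position of a i becomes 1.
  firedIndices : Subset w → Row w → Timed (Vec Bool w)
  firedIndices B r = do
    fired ← new w false
    loop (firedBody B r) fired

  markKept : Symbol w → Vec Bool w → Timed (Vec Bool w)
  markKept (b i) kept = write kept i true
  markKept _     kept = pure kept

  keptBody : Subset w → Row w → Fin w → Vec Bool w → Timed (Vec Bool w)
  keptBody B r p kept = do
    p∈B ← read B p
    if p∈B
      then pure kept
      else (do s ← read r p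
               markKept s kept)

  -- Entry i of the result: some position of b i lies outside B.
  keptIndices : Subset w → Row w → Timed (Vec Bool w)
  keptIndices B r = do
    kept ← new w false
    loop (keptBody B r) kept

  update : Vec Bool w → Vec Bool w → Fin w → Symbol w → Row w → Timed (Row w)
  update fired kept p (a i) r = do
    k ← read kept i
    if k then pure r else write r p 𝟐
  update fired kept p (b i) r = do
    f ← read fired i
    if f then write r p 𝟏 else pure r
  update fired kept p _ r = pure r

  case4Body : Subset w → Vec Bool w → Vec Bool w → Fin w → Row w → Timed (Row w)
  case4Body B fired kept p r = do
    p∈B ← read B p
    if p∈B
      then write r p 𝟏
      else (do s ← read r p
               update fired kept p s r)

  -- The row r″.
  case4 : Fin w → Subset w → Row w → Timed (Row w)
  case4 j B r = do
    fired ← firedIndices B r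
    kept  ← keptIndices B r
    r₁    ← loop (case4Body B fired kept) r
    write r₁ j 𝟏

  impose : Fin w → Subset w → Row w → Timed (List (Row w))
  impose j B r = do
    hasZero ← someIn B r isZero
    if hasZero
      then (do r₁ ← write r j 𝟎
               pure (r₁ ∷ []))
      else do
        hasIndexed ← someIn B r isIndexed
        if hasIndexed
          then (do c  ← copy r
                   r′ ← write c j 𝟎
                   r″ ← case4 j B r
                   pure (r′ ∷ r″ ∷ []))
          else do
            hasTwo ← someIn B r isTwo
            if hasTwo
              then (do r₁ ← case3 j B r
                       pure (r₁ ∷ []))
              else pure (r ∷ [])

  -- A row with its pending implication; the number w (one past the last
  -- position) means that all implications have been imposed.
  Entry : Set
  Entry = ℕ × Row w

  record Stacks : Set where
    constructor stacks
    field
      working : List Entry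
      final   : List (Row w)

  pushAll : ℕ → List (Row w) → List Entry → Timed (List Entry)
  pushAll k []       es = pure es
  pushAll k (r ∷ rs) es = do
    es₁ ← pushAll k rs es
    push (k , r) es₁

  -- The input is the table of lower covers.
  module _ (L : Vec (Subset w) w) where

    treatPending : ∀ {k} → Dec (k ℕ.< w) → Row w → Stacks → Timed Stacks
    treatPending (no _) r (stacks es fs) = do
      fs₁ ← push r fs
      pure (stacks es fs₁)
    treatPending {k} (yes k<w) r (stacks es fs) = do
      B   ← read L (fromℕ< k<w)
      rs  ← impose (fromℕ< k<w) B r
      es₁ ← pushAll (suc k) rs es
      pure (stacks es₁ fs)

    -- Treats the entry just popped from the working stack; the two units are
    -- for the pop and for comparing k with w.
    treat : Entry → Stacks → Timed Stacks
    treat (k , r) S = tick (tick (treatPending (k <? w) r S))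

    start : Timed Stacks
    start = do
      r  ← new w 𝟐
      es ← push (0 , r) []
      pure (stacks es [])

    -- Runs S F t: from S the main loop halts after time t with final stack F.
    data Runs : Stacks → List (Row w) → ℕ → Set where
      halt : ∀ {F} → Runs (stacks [] F) F 1
      next : ∀ {e es fs F t} →
             Runs (value (treat e (stacks es fs))) F t →
             Runs (stacks (e ∷ es) fs) F (time (treat e (stacks es fs)) + t)

    data Algorithm⇓ : List (Row w) → ℕ → Set where
      run : ∀ {F t} → Runs (value start) F t → Algorithm⇓ F (time start + t)

-- Algorithm⇓ is deterministic: a given table admits at most one pair of final
-- rows and running time.
ABAlgorithm : ∀ {w} → LabelledPoset w → List (Row w) → ℕ → Set
ABAlgorithm P = Algorithm⇓ (tabulate LC)
  where open LabelledPoset P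

{-# OPTIONS --safe #-}
module Submission where

-- In every row that arises, a i stands at position i only, so membership in
-- ⟦ r ⟧ is a condition on each single position, and a case of the imposition is
-- correct as soon as it is so position by position.  Each imposition costs O(w)
-- and never yields the empty list.  Hence the treated entries form a tree of
-- depth w whose leaves are the R final rows: it has at most R(w+1) nodes, and
-- the whole run takes time O(Rw²).

open import Defs
open import Data.Bool using (Bool; true; false)
open import Data.Empty using (⊥-elim)
open import Data.Fin as Fin using (Fin; zero; suc; toℕ; fromℕ<)
open import Data.Fin.Properties as Fin using (_≟_; toℕ<n; toℕ-fromℕ<; toℕ-injective; any?)
open import Data.Fin.Subset using (Subset; _∈_; _∉_; _⊆_)
open import Data.Fin.Subset.Properties using (_∈?_)
open import Data.List using (List; []; _∷_; _++_; length; map)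
open import Data.List.Properties using (++-assoc; ++-identityʳ; length-++; length-map)
open import Data.List.Relation.Unary.All as All using (All; []; _∷_)
import Data.List.Relation.Unary.All.Properties as All
open import Data.List.Relation.Unary.AllPairs using (AllPairs; []; _∷_)
import Data.List.Relation.Unary.AllPairs.Properties as AllPairs
open import Data.List.Relation.Unary.Any as Any using (Any; here; there)
import Data.List.Relation.Unary.Any.Properties as Any
open import Data.List.Membership.Propositional using (lose)
open import Data.Nat using (ℕ; zero; suc; _+_; _∸_; _≤_; _<_; _*_; _^_; _<?_; z≤n; s≤s; >-nonZero)
open import Data.Nat.Properties as ℕ
  using (≤-refl; ≤-reflexive; ≤-trans; +-mono-≤; module ≤-Reasoning)
open import Data.Nat.Tactic.RingSolver using (solve-∀)
open import Data.Product using (∃; ∃-syntax; _×_; _,_; proj₁; proj₂)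
open import Data.Sum using (_⊎_; inj₁; inj₂; [_,_]′)
open import Data.Unit using (⊤; tt)
open import Data.Vec using (Vec; lookup; replicate; tabulate; _[_]≔_)
open import Data.Vec.Properties
  using (lookup∘tabulate; lookup∘update; lookup∘update′; lookup-replicate;
         lookup⇒[]=; []=⇒lookup)
open import Function using (_∘_; _|>_; _⇔_; mk⇔; id)
open import Level using (0ℓ)
open import Relation.Binary.PropositionalEquality
  using (_≡_; _≢_; refl; sym; trans; cong; subst)
open import Relation.Nullary using (¬_; Dec; yes; no; does; contradiction; _×-dec_)
open import Relation.Nullary.Decidable using (dec-true)
open import Relation.Unary using (Pred; _∩_; _∪_; _⊥_; ∅)

open Function.Equivalence using (to; from)

-- Case 4 seems to call for a fixpoint: positions set to 1 fire premises, which set further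
-- positions to 1. There is no cascade, because a position carries a single symbol: a fired `a i`
-- raises positions carrying `b i`, and these hold no premise. One pass, guided by marks computed
-- from the old row, therefore yields r″. Time has to be bounded by the final rows although it is
-- spent on intermediate ones. So it is measured as a rate per final row: treating an entry raises
-- the rate of the rows below it by a fixed O(w). Such a bound is additive over pieces of the stack
-- and is proved together with the disjoint union. To make the last-in-first-out loop compositional,
-- each piece of the stack is described for every possible remainder beneath it.

module _ {A : Set} where

  -- Timed loops

  loop-time : ∀ {n} c (body : Fin n → A → Timed A) →
              (∀ p x → time (body p x) ≤ c) →
              ∀ x → time (loop body x) ≤ n * suc c
  loop-time {zero}  c body le x = z≤n
  loop-time {suc n} c body le x =
    s≤s (+-mono-≤ (le zero x) (loop-time c (body ∘ suc) (le ∘ suc) _))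

  -- For loops that only ever set flags: `Q` says that the observed flag is set, `P p` that
  -- iteration `p` sets it. An array of flags is handled entry by entry, with `Q` observing a fixed
  -- one.
  loop-collects : ∀ {n} (Q : A → Set) (P : Fin n → Set) (body : Fin n → A → Timed A) →
                  (∀ p x → Q (value (body p x)) ⇔ (Q x ⊎ P p)) →
                  ∀ x → Q (value (loop body x)) ⇔ (Q x ⊎ ∃ P)
  loop-collects {zero}  Q P body step x = mk⇔ inj₁ λ { (inj₁ q) → q ; (inj₂ (() , _)) }
  loop-collects {suc n} Q P body step x = mk⇔ collected collects
    where
    rest = loop-collects Q (P ∘ suc) (body ∘ suc) (step ∘ suc) (value (body zero x))

    collected : Q (value (loop body x)) → Q x ⊎ ∃ P
    collected q with to rest q
    ... | inj₂ (p , Pp) = inj₂ (suc p , Pp)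
    ... | inj₁ q₀ with to (step zero x) q₀
    ...   | inj₁ qx = inj₁ qx
    ...   | inj₂ Pz = inj₂ (zero , Pz)

    collects : Q x ⊎ ∃ P → Q (value (loop body x))
    collects (inj₁ qx)           = from rest (inj₁ (from (step zero x) (inj₁ qx)))
    collects (inj₂ (zero , Pz))  = from rest (inj₁ (from (step zero x) (inj₂ Pz)))
    collects (inj₂ (suc p , Pp)) = from rest (inj₂ (p , Pp))

  loop-frame : ∀ {n} {C : Set} (obs : A → C) (body : Fin n → A → Timed A) →
               (∀ p x → obs (value (body p x)) ≡ obs x) →
               ∀ x → obs (value (loop body x)) ≡ obs x
  loop-frame {zero}  obs body same x = refl
  loop-frame {suc n} obs body same x =
    trans (loop-frame obs (body ∘ suc) (same ∘ suc) _) (same zero x)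

  -- For loops that overwrite the very row they read. Iteration `q` alone touches the observed
  -- entry, so it still finds the initial value there, and no later iteration spoils its result.
  loop-at : ∀ {n} {C : Set} (obs : A → C) (R : C → C → Set)
            (body : Fin n → A → Timed A) (q : Fin n) →
            (∀ p x → q ≢ p → obs (value (body p x)) ≡ obs x) →
            (∀ x → R (obs x) (obs (value (body q x)))) →
            ∀ x → R (obs x) (obs (value (loop body x)))
  loop-at obs R body zero same acts x =
    subst (R (obs x)) (sym (loop-frame obs (body ∘ suc) (λ p y → same (suc p) y λ ()) _)) (acts x)
  loop-at obs R body (suc q) same acts x =
    subst (λ c → R c (obs (value (loop body x)))) (same zero x λ ())
      (loop-at obs R (body ∘ suc) q (λ p y q≢p → same (suc p) y (q≢p ∘ Fin.suc-injective)) acts _)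

outside : ∀ {w} {B : Subset w} {p} → lookup B p ≡ false → p ∉ B
outside eq p∈B with () ← trans (sym eq) ([]=⇒lookup p∈B)

a-injective : ∀ {w} {i j : Fin w} → a i ≡ a j → i ≡ j
a-injective refl = refl

isZero⇒𝟎 : ∀ {w} {s : Symbol w} → isZero s ≡ true → s ≡ 𝟎
isZero⇒𝟎 {s = 𝟎} _ = refl

isTwo⇒𝟐 : ∀ {w} {s : Symbol w} → isTwo s ≡ true → s ≡ 𝟐
isTwo⇒𝟐 {s = 𝟐} _ = refl

-- Rows and their meaning position by position

module _ {w : ℕ} where

  -- Here `k` implications have been imposed. Identifying an index with the position of its premise
  -- turns uniqueness of premises into `prem-at`; `prem⇒conc` keeps conclusions nonempty, and `free`
  -- guarantees the 𝟐 at the position about to be treated.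
  record Invariant (k : ℕ) (r : Row w) : Set where
    field
      prem-at   : ∀ {i p} → lookup r p ≡ a i → p ≡ i
      conc⇒prem : ∀ {i p} → lookup r p ≡ b i → lookup r i ≡ a i
      prem⇒conc : ∀ {i} → lookup r i ≡ a i → ∃[ p ] lookup r p ≡ b i
      free      : ∀ {p} → k ≤ toℕ p → lookup r p ≡ 𝟐

  open Invariant

  Invariant⇒IsRow : ∀ {k r} → Invariant k r → IsRow r
  Invariant⇒IsRow {k} {r} inv i (p , inj₁ rp≡a) with refl ← prem-at inv rp≡a =
    (p , (λ rq≡a → sym (prem-at inv rq≡a)) , λ { refl → rp≡a }) , prem⇒conc inv rp≡a
  Invariant⇒IsRow inv i (p , inj₂ rp≡b) =
    Invariant⇒IsRow inv i (i , inj₁ (conc⇒prem inv rp≡b))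

  -- The implication with index `i` is placed entirely on the positions of `b i`, so `a i`
  -- constrains nothing. This is possible because its premise is the position `i` itself.
  Allows : Subset w → Fin w → Symbol w → Set
  Allows X p 𝟎     = p ∉ X
  Allows X p 𝟏     = p ∈ X
  Allows X p 𝟐     = ⊤
  Allows X p (a i) = ⊤
  Allows X p (b i) = i ∈ X → p ∈ X

  ⟦⟧⇔Allows : ∀ {k r X} → Invariant k r → ⟦ r ⟧ X ⇔ (∀ p → Allows X p (lookup r p))
  ⟦⟧⇔Allows {k} {r} {X} inv = mk⇔ pointwise global
    where
    pointwise : ⟦ r ⟧ X → ∀ p → Allows X p (lookup r p)
    pointwise (1⊆ , 0⊥ , imp) p with lookup r p in eq
    ... | 𝟎   = λ p∈X → 0⊥ (eq , p∈X)
    ... | 𝟏   = 1⊆ eq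
    ... | 𝟐   = tt
    ... | a i = tt
    ... | b i = λ i∈X → imp i (λ rq≡a → subst (_∈ X) (sym (prem-at inv rq≡a)) i∈X) eq

    global : (∀ p → Allows X p (lookup r p)) → ⟦ r ⟧ X
    global al =
        (λ {p} eq → subst (Allows X p) eq (al p))
      , (λ { {p} (eq , p∈X) → subst (Allows X p) eq (al p) p∈X })
      , (λ i i∈ {p} eq → subst (Allows X p) eq (al p) (i∈ (conc⇒prem inv eq)))

  Implies : Fin w → Subset w → Pred (Subset w) 0ℓ
  Implies j B X = j ∈ X → B ⊆ X

  -- Scans of a row and arrays of marks

  SomeIn : Subset w → Row w → (Symbol w → Bool) → Set
  SomeIn B r f = ∃[ p ] (p ∈ B × f (lookup r p) ≡ true)

  ⇔-⊎ : ∀ {A B : Set} → ¬ B → A ⇔ (A ⊎ B)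
  ⇔-⊎ ¬B = mk⇔ inj₁ [ id , ⊥-elim ∘ ¬B ]′

  someIn-spec : ∀ B r f → value (someIn B r f) ≡ true ⇔ SomeIn B r f
  someIn-spec B r f = mk⇔ (λ eq → [ (λ ()) , id ]′ (to spec eq)) (from spec ∘ inj₂)
    where
    step : ∀ p found → value (someInBody B r f p found) ≡ true ⇔
           (found ≡ true ⊎ (p ∈ B × f (lookup r p) ≡ true))
    step p found with lookup B p in eq
    ... | false = ⇔-⊎ (outside eq ∘ proj₁)
    step p true  | true = mk⇔ (λ _ → inj₁ refl) (λ _ → refl)
    step p false | true =
      mk⇔ (λ t → inj₂ (lookup⇒[]= p B eq , t)) λ { (inj₁ ()) ; (inj₂ (_ , t)) → t }

    spec = loop-collects (_≡ true) _ (someInBody B r f) step false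

  someIn-none : ∀ B r f → value (someIn B r f) ≡ false → ¬ SomeIn B r f
  someIn-none B r f eq some with () ← trans (sym eq) (from (someIn-spec B r f) some)

  someIn-time : ∀ (B : Subset w) r f → time (someIn B r f) ≤ w * 3
  someIn-time B r f = loop-time 2 (someInBody B r f) step false
    where
    step : ∀ p x → time (someInBody B r f p x) ≤ 2
    step p x with lookup B p
    ... | true  = ≤-refl
    ... | false = s≤s z≤n

  -- Both are read off the old row. `Kept` ignores conclusions lost by firing, which does no harm:
  -- if `i` is fired, its premise lies in `B` and becomes 𝟏 anyway.
  Fired Kept : Subset w → Row w → Fin w → Set
  Fired B r i = ∃[ p ] (p ∈ B × lookup r p ≡ a i)
  Kept  B r i = ∃[ p ] (p ∉ B × lookup r p ≡ b i)

  mark-spec : ∀ i j (v : Vec Bool w) →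
             lookup (v [ j ]≔ true) i ≡ true ⇔ (lookup v i ≡ true ⊎ j ≡ i)
  mark-spec i j v with i ≟ j
  ... | yes refl = mk⇔ (λ _ → inj₂ refl) (λ _ → lookup∘update i v true)
  ... | no i≢j   = mk⇔ (λ t → inj₁ (trans (sym (lookup∘update′ i≢j v true)) t))
    λ { (inj₁ t) → trans (lookup∘update′ i≢j v true) t
      ; (inj₂ j≡i) → ⊥-elim (i≢j (sym j≡i)) }

  firedIndices-spec : ∀ B r i → lookup (value (firedIndices B r)) i ≡ true ⇔ Fired B r i
  firedIndices-spec B r i =
    mk⇔ (λ eq → [ (λ t → contradiction (trans (sym t) (lookup-replicate i false)) λ ()) , id ]′
                  (to spec eq))
        (from spec ∘ inj₂)
    where
    step : ∀ p v → lookup (value (firedBody B r p v)) i ≡ true ⇔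
           (lookup v i ≡ true ⊎ (p ∈ B × lookup r p ≡ a i))
    step p v with lookup B p in eq
    ... | false = ⇔-⊎ (outside eq ∘ proj₁)
    ... | true with lookup r p
    ...   | 𝟎   = ⇔-⊎ λ ()
    ...   | 𝟏   = ⇔-⊎ λ ()
    ...   | 𝟐   = ⇔-⊎ λ ()
    ...   | b _ = ⇔-⊎ λ ()
    ...   | a j = mk⇔
      (λ t → [ inj₁ , (λ { refl → inj₂ (lookup⇒[]= p B eq , refl) }) ]′ (to (mark-spec i j v) t))
      (from (mark-spec i j v) ∘ λ { (inj₁ t) → inj₁ t ; (inj₂ (_ , refl)) → inj₂ refl })

    spec = loop-collects (λ v → lookup v i ≡ true) _ (firedBody B r) step (replicate w false)

  keptIndices-spec : ∀ B r i → lookup (value (keptIndices B r)) i ≡ true ⇔ Kept B r i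
  keptIndices-spec B r i =
    mk⇔ (λ eq → [ (λ t → contradiction (trans (sym t) (lookup-replicate i false)) λ ()) , id ]′
                  (to spec eq))
        (from spec ∘ inj₂)
    where
    step : ∀ p v → lookup (value (keptBody B r p v)) i ≡ true ⇔
           (lookup v i ≡ true ⊎ (p ∉ B × lookup r p ≡ b i))
    step p v with lookup B p in eq
    ... | true = ⇔-⊎ λ (p∉B , _) → p∉B (lookup⇒[]= p B eq)
    ... | false with lookup r p
    ...   | 𝟎   = ⇔-⊎ λ ()
    ...   | 𝟏   = ⇔-⊎ λ ()
    ...   | 𝟐   = ⇔-⊎ λ ()
    ...   | a _ = ⇔-⊎ λ ()
    ...   | b j = mk⇔
      (λ t → [ inj₁ , (λ { refl → inj₂ (outside eq , refl) }) ]′ (to (mark-spec i j v) t))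
      (from (mark-spec i j v) ∘ λ { (inj₁ t) → inj₁ t ; (inj₂ (_ , refl)) → inj₂ refl })

    spec = loop-collects (λ v → lookup v i ≡ true) _ (keptBody B r) step (replicate w false)

  firedIndices-time : ∀ (B : Subset w) r → time (firedIndices B r) ≤ w + w * 4
  firedIndices-time B r = +-mono-≤ (≤-refl {w}) (loop-time 3 (firedBody B r) step (replicate w false))
    where
    step : ∀ p v → time (firedBody B r p v) ≤ 3
    step p v with lookup B p
    ... | false = s≤s z≤n
    ... | true with lookup r p
    ...   | 𝟎   = s≤s (s≤s z≤n)
    ...   | 𝟏   = s≤s (s≤s z≤n)
    ...   | 𝟐   = s≤s (s≤s z≤n)
    ...   | a _ = ≤-refl
    ...   | b _ = s≤s (s≤s z≤n)

  keptIndices-time : ∀ (B : Subset w) r → time (keptIndices B r) ≤ w + w * 4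
  keptIndices-time B r = +-mono-≤ (≤-refl {w}) (loop-time 3 (keptBody B r) step (replicate w false))
    where
    step : ∀ p v → time (keptBody B r p v) ≤ 3
    step p v with lookup B p
    ... | true = s≤s z≤n
    ... | false with lookup r p
    ...   | 𝟎   = s≤s (s≤s z≤n)
    ...   | 𝟏   = s≤s (s≤s z≤n)
    ...   | 𝟐   = s≤s (s≤s z≤n)
    ...   | a _ = s≤s (s≤s z≤n)
    ...   | b _ = ≤-refl

  -- Correctness of one imposition

  record Imposed (j : Fin w) (B : Subset w) (r : Row w) (rs : List (Row w)) : Set where
    field
      nonempty   : 1 ≤ length rs
      invariant  : All (Invariant (suc (toℕ j))) rs
      represents : IsDisjointUnionOf (⟦ r ⟧ ∩ Implies j B) rs

  imposed₁ : ∀ {j B r r₁} → Invariant (suc (toℕ j)) r₁ →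
             (∀ {X} → ⟦ r₁ ⟧ X ⇔ (⟦ r ⟧ ∩ Implies j B) X) → Imposed j B r (r₁ ∷ [])
  imposed₁ inv₁ eqv = record
    { nonempty   = s≤s z≤n
    ; invariant  = inv₁ ∷ []
    ; represents = (λ X → mk⇔ (here ∘ from eqv) λ { (here x) → to eqv x ; (there ()) }) , [] ∷ []
    }

  -- Linked j B p s s′ and Raised B r p s s′: in case 3 and for the row r″ of
  -- case 4, respectively, the symbol s at a position p ≠ j becomes s′.
  data Linked (j : Fin w) (B : Subset w) (p : Fin w) : Symbol w → Symbol w → Set where
    link : p ∈ B → Linked j B p 𝟐 (b j)
    same : ∀ {s} → (p ∈ B → s ≢ 𝟐) → Linked j B p s s

  data Raised (B : Subset w) (r : Row w) (p : Fin w) : Symbol w → Symbol w → Set where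
    raise   : ∀ {s} → p ∈ B → Raised B r p s 𝟏
    release : ∀ {i} → p ∉ B → ¬ Kept B r i → Raised B r p (a i) 𝟐
    retain  : ∀ {i} → p ∉ B → Kept B r i → Raised B r p (a i) (a i)
    fire    : ∀ {i} → p ∉ B → Fired B r i → Raised B r p (b i) 𝟏
    wait    : ∀ {i} → p ∉ B → ¬ Fired B r i → Raised B r p (b i) (b i)
    same    : ∀ {s} → p ∉ B → isIndexed s ≡ false → Raised B r p s s

  module Imposing {j : Fin w} {B : Subset w} {r : Row w}
                  (below : ∀ {p} → p ∈ B → p Fin.< j) (inv : Invariant (toℕ j) r) where

    rj≡𝟐 : lookup r j ≡ 𝟐
    rj≡𝟐 = free inv ≤-refl

    ∈B⇒≢j : ∀ {p} → p ∈ B → p ≢ j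
    ∈B⇒≢j p∈B refl = ℕ.<-irrefl refl (below p∈B)

    above∉B : ∀ {p} → toℕ j < toℕ p → p ∉ B
    above∉B j<p p∈B = ℕ.<-asym j<p (below p∈B)

    above≢j : ∀ {p} → toℕ j < toℕ p → p ≢ j
    above≢j j<p refl = ℕ.<-irrefl refl j<p

    indexed≢j : ∀ {p s} → lookup r p ≡ s → s ≢ 𝟐 → p ≢ j
    indexed≢j rp≡s s≢𝟐 refl = s≢𝟐 (trans (sym rp≡s) rj≡𝟐)

    -- The result of case 1 and also the row r′ of case 4.
    r[j≔𝟎] : Row w
    r[j≔𝟎] = r [ j ]≔ 𝟎

    forbid-at : lookup r[j≔𝟎] j ≡ 𝟎
    forbid-at = lookup∘update j r 𝟎

    forbid-≢ : ∀ {p} → p ≢ j → lookup r[j≔𝟎] p ≡ lookup r p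
    forbid-≢ p≢j = lookup∘update′ p≢j r 𝟎

    forbid-reflects : ∀ {p s} → s ≢ 𝟎 → lookup r[j≔𝟎] p ≡ s → lookup r p ≡ s
    forbid-reflects {p} s≢𝟎 eq with p ≟ j
    ... | yes refl = contradiction (trans (sym eq) forbid-at) s≢𝟎
    ... | no p≢j   = trans (sym (forbid-≢ p≢j)) eq

    forbid-preserves : ∀ {p s} → s ≢ 𝟐 → lookup r p ≡ s → lookup r[j≔𝟎] p ≡ s
    forbid-preserves s≢𝟐 eq = trans (forbid-≢ (indexed≢j eq s≢𝟐)) eq

    forbid-invariant : Invariant (suc (toℕ j)) r[j≔𝟎]
    forbid-invariant = record
      { prem-at   = λ eq → prem-at inv (forbid-reflects (λ ()) eq)
      ; conc⇒prem = λ eq → forbid-preserves (λ ()) (conc⇒prem inv (forbid-reflects (λ ()) eq))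
      ; prem⇒conc = λ eq → let p , rp≡b = prem⇒conc inv (forbid-reflects (λ ()) eq)
                           in p , forbid-preserves (λ ()) rp≡b
      ; free      = λ j<p → trans (forbid-≢ (above≢j j<p)) (free inv (ℕ.<⇒≤ j<p))
      }

    forbid-⟦⟧ : ∀ {X} → ⟦ r[j≔𝟎] ⟧ X ⇔ (⟦ r ⟧ X × j ∉ X)
    forbid-⟦⟧ {X} = mk⇔
      (λ x → let al = to (⟦⟧⇔Allows forbid-invariant) x in
        from (⟦⟧⇔Allows inv) (weaken al) , subst (Allows X j) forbid-at (al j))
      (λ (x , j∉X) → from (⟦⟧⇔Allows forbid-invariant)
        (strengthen (to (⟦⟧⇔Allows inv) x) j∉X))
      where
      weaken : (∀ p → Allows X p (lookup r[j≔𝟎] p)) → ∀ p → Allows X p (lookup r p)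
      weaken al p with p ≟ j
      ... | yes refl = subst (Allows X j) (sym rj≡𝟐) tt
      ... | no p≢j   = subst (Allows X p) (forbid-≢ p≢j) (al p)

      strengthen : (∀ p → Allows X p (lookup r p)) → j ∉ X →
                   ∀ p → Allows X p (lookup r[j≔𝟎] p)
      strengthen al j∉X p with p ≟ j
      ... | yes refl = subst (Allows X j) (sym forbid-at) j∉X
      ... | no p≢j   = subst (Allows X p) (sym (forbid-≢ p≢j)) (al p)

    -- A zero in `B` makes the conclusion impossible for members of `⟦ r ⟧`, so the implication
    -- amounts to `j ∉ X`.
    case1-imposed : SomeIn B r isZero → Imposed j B r (r[j≔𝟎] ∷ [])
    case1-imposed (z , z∈B , rz≡𝟎) = imposed₁ forbid-invariant (mk⇔
      (λ x → let x₀ , j∉X = to forbid-⟦⟧ x in x₀ , λ j∈X → contradiction j∈X j∉X)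
      (λ ((x@(_ , 0⊥ , _)) , imp) → from forbid-⟦⟧
        (x , λ j∈X → 0⊥ (isZero⇒𝟎 rz≡𝟎 , imp j∈X z∈B))))

    case2-imposed : ¬ SomeIn B r isZero → ¬ SomeIn B r isIndexed → ¬ SomeIn B r isTwo →
                    Imposed j B r (r ∷ [])
    case2-imposed no𝟎 noab no𝟐 = imposed₁
      (record { Invariant inv ; free = free inv ∘ ℕ.<⇒≤ })
      (mk⇔ (λ x → x , λ _ {_} p∈B → proj₁ x (B-ones p∈B)) proj₁)
      where
      B-ones : ∀ {p} → p ∈ B → lookup r p ≡ 𝟏
      B-ones {p} p∈B with lookup r p in eq
      ... | 𝟎   = ⊥-elim (no𝟎 (p , p∈B , cong isZero eq))
      ... | 𝟏   = refl
      ... | 𝟐   = ⊥-elim (no𝟐 (p , p∈B , cong isTwo eq))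
      ... | a _ = ⊥-elim (noab (p , p∈B , cong isIndexed eq))
      ... | b _ = ⊥-elim (noab (p , p∈B , cong isIndexed eq))

    -- Case 3: a new premise with its conclusion

    linked : Row w
    linked = value (loop (case3Body j B) r)

    r₃ : Row w
    r₃ = value (case3 j B r)

    case3-at : lookup r₃ j ≡ a j
    case3-at = lookup∘update j linked (a j)

    case3-≢ : ∀ {p} → p ≢ j → Linked j B p (lookup r p) (lookup r₃ p)
    case3-≢ {p} p≢j = subst (Linked j B p (lookup r p)) (sym (lookup∘update′ p≢j linked (a j)))
      (loop-at (λ x → lookup x p) (Linked j B p) (case3Body j B) p elsewhere acts r)
      where
      elsewhere : ∀ q x → p ≢ q → lookup (value (case3Body j B q x)) p ≡ lookup x p
      elsewhere q x p≢q with lookup B q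
      ... | false = refl
      ... | true with isTwo (lookup x q)
      ...   | true  = lookup∘update′ p≢q x (b j)
      ...   | false = refl

      acts : ∀ x → Linked j B p (lookup x p) (lookup (value (case3Body j B p x)) p)
      acts x with lookup B p in p∈B
      ... | false = same (⊥-elim ∘ outside p∈B)
      ... | true with isTwo (lookup x p) in two
      ...   | true  rewrite lookup∘update p x (b j) | isTwo⇒𝟐 two = link (lookup⇒[]= p B p∈B)
      ...   | false = same λ _ eq → contradiction (trans (sym two) (cong isTwo eq)) λ ()

    linked-a : ∀ {p s i} → Linked j B p s (a i) → s ≡ a i
    linked-a (same _) = refl

    linked-b : ∀ {p s i} → Linked j B p s (b i) → (p ∈ B × s ≡ 𝟐 × i ≡ j) ⊎ s ≡ b i
    linked-b (link p∈B) = inj₁ (p∈B , refl , refl)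
    linked-b (same _)   = inj₂ refl

    linked-kept : ∀ {p s s′ t} → s ≡ t → t ≢ 𝟐 → Linked j B p s s′ → s′ ≡ t
    linked-kept eq t≢𝟐 (link _) = contradiction (sym eq) t≢𝟐
    linked-kept eq t≢𝟐 (same _) = eq

    linked-two : ∀ {p s s′} → s ≡ 𝟐 → p ∈ B → Linked j B p s s′ → s′ ≡ b j
    linked-two eq p∈B (link _)   = refl
    linked-two eq p∈B (same not) = contradiction eq (not p∈B)

    linked-free : ∀ {p s s′} → s ≡ 𝟐 → p ∉ B → Linked j B p s s′ → s′ ≡ 𝟐
    linked-free eq p∉B (link p∈B) = contradiction p∈B p∉B
    linked-free eq p∉B (same _)   = eq

    -- The 𝟐 found in `B` becomes a `b j`, which gives the new pair a nonempty conclusion. The index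
    -- `j` is fresh: an old `b j` would, by `conc⇒prem`, force `a j` at `j`, where `r` carries 𝟐.
    case3-invariant : SomeIn B r isTwo → Invariant (suc (toℕ j)) r₃
    case3-invariant (t , t∈B , rt≡𝟐) = record
      { prem-at   = prem-at₃
      ; conc⇒prem = conc⇒prem₃
      ; prem⇒conc = prem⇒conc₃
      ; free      = λ j<p → linked-free (free inv (ℕ.<⇒≤ j<p)) (above∉B j<p)
                                 (case3-≢ (above≢j j<p))
      }
      where
      preserves : ∀ {p s} → s ≢ 𝟐 → lookup r p ≡ s → lookup r₃ p ≡ s
      preserves s≢𝟐 eq = linked-kept eq s≢𝟐 (case3-≢ (indexed≢j eq s≢𝟐))

      a-reflects : ∀ {p i} → p ≢ j → lookup r₃ p ≡ a i → lookup r p ≡ a i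
      a-reflects p≢j eq = linked-a (subst (Linked j B _ _) eq (case3-≢ p≢j))

      prem-at₃ : ∀ {i p} → lookup r₃ p ≡ a i → p ≡ i
      prem-at₃ {i} {p} eq with p ≟ j
      ... | yes refl = a-injective (trans (sym case3-at) eq)
      ... | no p≢j   = prem-at inv (a-reflects p≢j eq)

      conc⇒prem₃ : ∀ {i p} → lookup r₃ p ≡ b i → lookup r₃ i ≡ a i
      conc⇒prem₃ {i} {p} eq with p ≟ j
      ... | yes refl = contradiction (trans (sym case3-at) eq) λ ()
      ... | no p≢j with linked-b (subst (Linked j B _ _) eq (case3-≢ p≢j))
      ...   | inj₁ (_ , _ , refl) = case3-at
      ...   | inj₂ rp≡b           = preserves (λ ()) (conc⇒prem inv rp≡b)

      prem⇒conc₃ : ∀ {i} → lookup r₃ i ≡ a i → ∃[ p ] lookup r₃ p ≡ b i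
      prem⇒conc₃ {i} eq with i ≟ j
      ... | yes refl = t , linked-two (isTwo⇒𝟐 rt≡𝟐) t∈B (case3-≢ (∈B⇒≢j t∈B))
      ... | no i≢j   = let p , rp≡b = prem⇒conc inv (a-reflects i≢j eq)
                       in p , preserves (λ ()) rp≡b

    -- With zeros and indexed symbols excluded, `B` carries only 𝟏 and 𝟐. The 𝟏s meet their share of
    -- the conclusion already, so linking just the 𝟐s to `a j` expresses the whole implication.
    case3-imposed : ¬ SomeIn B r isZero → ¬ SomeIn B r isIndexed → SomeIn B r isTwo →
                    Imposed j B r (r₃ ∷ [])
    case3-imposed no𝟎 noab some𝟐 = imposed₁ inv₃ (λ {X} → mk⇔
      (λ x → let al = to (⟦⟧⇔Allows inv₃) x in
        from (⟦⟧⇔Allows inv) (weaken al) , implies al)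
      (λ (x , imp) → from (⟦⟧⇔Allows inv₃) (strengthen (to (⟦⟧⇔Allows inv) x) imp)))
      where
      inv₃ = case3-invariant some𝟐

      module _ {X : Subset w} where
        weaken : (∀ p → Allows X p (lookup r₃ p)) → ∀ p → Allows X p (lookup r p)
        weaken al p with p ≟ j
        ... | yes refl = subst (Allows X j) (sym rj≡𝟐) tt
        ... | no p≢j with lookup r p | lookup r₃ p | case3-≢ p≢j | al p
        ...   | _ | _ | link _ | _  = tt
        ...   | _ | _ | same _ | ok = ok

        implies : (∀ p → Allows X p (lookup r₃ p)) → Implies j B X
        implies al j∈X {p} p∈B
          with lookup r p in eq | lookup r₃ p | case3-≢ {p} (∈B⇒≢j p∈B) | al p
        ... | _   | _ | link _     | ok = ok j∈X
        ... | 𝟎   | _ | same _     | _  = ⊥-elim (no𝟎 (p , p∈B , cong isZero eq))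
        ... | 𝟏   | _ | same _     | ok = ok
        ... | 𝟐   | _ | same not   | _  = contradiction refl (not p∈B)
        ... | a _ | _ | same _     | _  = ⊥-elim (noab (p , p∈B , cong isIndexed eq))
        ... | b _ | _ | same _     | _  = ⊥-elim (noab (p , p∈B , cong isIndexed eq))

        strengthen : (∀ p → Allows X p (lookup r p)) → Implies j B X →
                     ∀ p → Allows X p (lookup r₃ p)
        strengthen al imp p with p ≟ j
        ... | yes refl = subst (Allows X j) (sym case3-at) tt
        ... | no p≢j with lookup r p | lookup r₃ p | case3-≢ p≢j | al p
        ...   | _ | _ | link p∈B | _  = λ j∈X → imp j∈X p∈B
        ...   | _ | _ | same _   | ok = ok

    -- Case 4: splitting by membership of j

    fired kept : Vec Bool w
    fired = value (firedIndices B r)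
    kept  = value (keptIndices B r)

    raised : Row w
    raised = value (loop (case4Body B fired kept) r)

    r″ : Row w
    r″ = value (case4 j B r)

    case4-at : lookup r″ j ≡ 𝟏
    case4-at = lookup∘update j raised 𝟏

    -- The loop overwrites the row it scans, but its marks were computed from the untouched `r`;
    -- hence `Raised` can speak of `Fired` and `Kept` in `r`.
    case4-≢ : ∀ {p} → p ≢ j → Raised B r p (lookup r p) (lookup r″ p)
    case4-≢ {p} p≢j = subst (Raised B r p (lookup r p)) (sym (lookup∘update′ p≢j raised 𝟏))
      (loop-at (λ x → lookup x p) (Raised B r p) (case4Body B fired kept) p elsewhere acts r)
      where
      elsewhere : ∀ q x → p ≢ q → lookup (value (case4Body B fired kept q x)) p ≡ lookup x p
      elsewhere q x p≢q with lookup B q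
      ... | true = lookup∘update′ p≢q x 𝟏
      ... | false with lookup x q
      ...   | 𝟎 = refl
      ...   | 𝟏 = refl
      ...   | 𝟐 = refl
      ...   | a i with lookup kept i
      ...     | true  = refl
      ...     | false = lookup∘update′ p≢q x 𝟐
      elsewhere q x p≢q | false | b i with lookup fired i
      ...     | true  = lookup∘update′ p≢q x 𝟏
      ...     | false = refl

      updates : ∀ {s} x → lookup x p ≡ s → p ∉ B →
                Raised B r p s (lookup (value (update fired kept p s x)) p)
      updates {𝟎} x eq p∉B rewrite eq = same p∉B refl
      updates {𝟏} x eq p∉B rewrite eq = same p∉B refl
      updates {𝟐} x eq p∉B rewrite eq = same p∉B refl
      updates {a i} x eq p∉B with lookup kept i in k
      ... | true  rewrite eq = retain p∉B (to (keptIndices-spec B r i) k)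
      ... | false rewrite lookup∘update p x 𝟐 = release p∉B λ kept-i →
        contradiction (trans (sym k) (from (keptIndices-spec B r i) kept-i)) λ ()
      updates {b i} x eq p∉B with lookup fired i in f
      ... | true  rewrite lookup∘update p x 𝟏 = fire p∉B (to (firedIndices-spec B r i) f)
      ... | false rewrite eq = wait p∉B λ fired-i →
        contradiction (trans (sym f) (from (firedIndices-spec B r i) fired-i)) λ ()

      acts : ∀ x → Raised B r p (lookup x p) (lookup (value (case4Body B fired kept p x)) p)
      acts x with lookup B p in p∈B
      ... | true rewrite lookup∘update p x 𝟏 = raise (lookup⇒[]= p B p∈B)
      ... | false = updates x refl (outside p∈B)

    raised-a : ∀ {p s i} → Raised B r p s (a i) → s ≡ a i × p ∉ B × Kept B r i
    raised-a (retain p∉B kept) = refl , p∉B , kept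

    raised-b : ∀ {p s i} → Raised B r p s (b i) → s ≡ b i × p ∉ B × ¬ Fired B r i
    raised-b (wait p∉B unfired) = refl , p∉B , unfired

    raised-retain : ∀ {p s s′ i} → s ≡ a i → p ∉ B → Kept B r i → Raised B r p s s′ → s′ ≡ a i
    raised-retain _    p∉B kept (raise p∈B)        = contradiction p∈B p∉B
    raised-retain refl p∉B kept (release _ ¬kept)  = contradiction kept ¬kept
    raised-retain refl p∉B kept (retain _ _)       = refl
    raised-retain refl p∉B kept (same _ ())

    raised-wait : ∀ {p s s′ i} → s ≡ b i → p ∉ B → ¬ Fired B r i → Raised B r p s s′ → s′ ≡ b i
    raised-wait _    p∉B unfired (raise p∈B)    = contradiction p∈B p∉B
    raised-wait refl p∉B unfired (fire _ fired) = contradiction fired unfired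
    raised-wait refl p∉B unfired (wait _ _)     = refl
    raised-wait refl p∉B unfired (same _ ())

    raised-free : ∀ {p s s′} → s ≡ 𝟐 → p ∉ B → Raised B r p s s′ → s′ ≡ 𝟐
    raised-free _    p∉B (raise p∈B) = contradiction p∈B p∉B
    raised-free refl p∉B (same _ _)  = refl

    -- A surviving `b i` is itself the witness that `a i` is kept, and `i` lies outside `B` because
    -- otherwise `i` would have fired. Conversely, a surviving `a i` has a `b i` outside `B`, which
    -- survives since the only premise with index `i` stands at `i`, outside `B`.
    case4-invariant : Invariant (suc (toℕ j)) r″
    case4-invariant = record
      { prem-at   = λ eq → prem-at inv (proj₁ (a-reflects eq))
      ; conc⇒prem = λ {i} eq → let rp≡b , p∉B , unfired = b-reflects eq
                                   ri≡a = conc⇒prem inv rp≡b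
          in raised-retain ri≡a (λ i∈B → unfired (i , i∈B , ri≡a)) (_ , p∉B , rp≡b)
               (case4-≢ (indexed≢j ri≡a λ ()))
      ; prem⇒conc = λ {i} eq → let ri≡a , i∉B , q , q∉B , rq≡b = a-reflects eq
          in q , raised-wait rq≡b q∉B
                   (λ (p , p∈B , rp≡a) → i∉B (subst (_∈ B) (prem-at inv rp≡a) p∈B))
                   (case4-≢ (indexed≢j rq≡b λ ()))
      ; free      = λ j<p → raised-free (free inv (ℕ.<⇒≤ j<p)) (above∉B j<p)
                                 (case4-≢ (above≢j j<p))
      }
      where
      a-reflects : ∀ {p i} → lookup r″ p ≡ a i → lookup r p ≡ a i × p ∉ B × Kept B r i
      a-reflects {p} eq with p ≟ j
      ... | yes refl = contradiction (trans (sym case4-at) eq) λ ()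
      ... | no p≢j   = raised-a (subst (Raised B r p _) eq (case4-≢ p≢j))

      b-reflects : ∀ {p i} → lookup r″ p ≡ b i → lookup r p ≡ b i × p ∉ B × ¬ Fired B r i
      b-reflects {p} eq with p ≟ j
      ... | yes refl = contradiction (trans (sym case4-at) eq) λ ()
      ... | no p≢j   = raised-b (subst (Raised B r p _) eq (case4-≢ p≢j))

    -- A 𝟏 meets the demand of every nonzero symbol, so the old symbols may be restored once `B` has
    -- no zero. In the other direction, a position other than `j` and outside `B` is raised only by
    -- a fired index, and then the old implication already forces it into `X`.
    case4-⟦⟧ : ¬ SomeIn B r isZero → ∀ {X} → ⟦ r″ ⟧ X ⇔ (⟦ r ⟧ X × j ∈ X × B ⊆ X)
    case4-⟦⟧ no𝟎 {X} = mk⇔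
      (λ x → let al = to (⟦⟧⇔Allows case4-invariant) x in
        from (⟦⟧⇔Allows inv) (weaken al) , subst (Allows X j) case4-at (al j) , λ {q} → B⊆X al {q})
      (λ (x , j∈X , B⊆X) → from (⟦⟧⇔Allows case4-invariant)
        (strengthen (to (⟦⟧⇔Allows inv) x) j∈X B⊆X))
      where
      B⊆X : (∀ p → Allows X p (lookup r″ p)) → B ⊆ X
      B⊆X al {p} p∈B with lookup r p | lookup r″ p | case4-≢ {p} (∈B⇒≢j p∈B) | al p
      ... | _ | _ | raise _       | ok = ok
      ... | _ | _ | release p∉B _ | _  = contradiction p∈B p∉B
      ... | _ | _ | retain p∉B _  | _  = contradiction p∈B p∉B
      ... | _ | _ | fire p∉B _    | _  = contradiction p∈B p∉B
      ... | _ | _ | wait p∉B _    | _  = contradiction p∈B p∉B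
      ... | _ | _ | same p∉B _    | _  = contradiction p∈B p∉B

      allows-member : ∀ {p} s → p ∈ B → p ∈ X → lookup r p ≡ s → Allows X p s
      allows-member 𝟎     p∈B p∈X eq = ⊥-elim (no𝟎 (_ , p∈B , cong isZero eq))
      allows-member 𝟏     p∈B p∈X eq = p∈X
      allows-member 𝟐     p∈B p∈X eq = tt
      allows-member (a _) p∈B p∈X eq = tt
      allows-member (b _) p∈B p∈X eq = λ _ → p∈X

      weaken : (∀ p → Allows X p (lookup r″ p)) → ∀ p → Allows X p (lookup r p)
      weaken al p with p ≟ j
      ... | yes refl = subst (Allows X j) (sym rj≡𝟐) tt
      ... | no p≢j with lookup r p in eq | lookup r″ p | case4-≢ p≢j | al p
      ...   | s | _ | raise p∈B   | ok = allows-member s p∈B ok eq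
      ...   | _ | _ | release _ _ | _  = tt
      ...   | _ | _ | retain _ _  | _  = tt
      ...   | _ | _ | fire _ _    | ok = λ _ → ok
      ...   | _ | _ | wait _ _    | ok = ok
      ...   | _ | _ | same _ _    | ok = ok

      strengthen : (∀ p → Allows X p (lookup r p)) → j ∈ X → B ⊆ X →
                   ∀ p → Allows X p (lookup r″ p)
      strengthen al j∈X B⊆X p with p ≟ j
      ... | yes refl = subst (Allows X j) (sym case4-at) j∈X
      ... | no p≢j with lookup r p | lookup r″ p | case4-≢ p≢j | al p
      ...   | _ | _ | raise p∈B             | _  = B⊆X p∈B
      ...   | _ | _ | release _ _           | _  = tt
      ...   | _ | _ | retain _ _            | _  = tt
      ...   | _ | _ | fire _ (q , q∈B , eq) | ok = ok (subst (_∈ X) (prem-at inv eq) (B⊆X q∈B))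
      ...   | _ | _ | wait _ _              | ok = ok
      ...   | _ | _ | same _ _              | ok = ok

    -- The two rows separate the sets by whether they contain `j`, whence disjointness.
    case4-imposed : ¬ SomeIn B r isZero → Imposed j B r (r[j≔𝟎] ∷ r″ ∷ [])
    case4-imposed no𝟎 = record
      { nonempty   = s≤s z≤n
      ; invariant  = forbid-invariant ∷ case4-invariant ∷ []
      ; represents = (λ X → mk⇔ split merge)
                   , ((λ (x′ , x″) → proj₂ (to forbid-⟦⟧ x′)
                       (proj₁ (proj₂ (to (case4-⟦⟧ no𝟎) x″)))) ∷ [])
                   ∷ [] ∷ []
      }
      where
      split : ∀ {X} → (⟦ r ⟧ ∩ Implies j B) X → Any (λ s → ⟦ s ⟧ X) (r[j≔𝟎] ∷ r″ ∷ [])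
      split {X} (x , imp) with j ∈? X
      ... | yes j∈X = there (here (from (case4-⟦⟧ no𝟎) (x , j∈X , imp j∈X)))
      ... | no j∉X  = here (from forbid-⟦⟧ (x , j∉X))

      merge : ∀ {X} → Any (λ s → ⟦ s ⟧ X) (r[j≔𝟎] ∷ r″ ∷ []) → (⟦ r ⟧ ∩ Implies j B) X
      merge (here x′) = let x , j∉X = to forbid-⟦⟧ x′ in x , λ j∈X → contradiction j∈X j∉X
      merge (there (here x″)) = let x , _ , B⊆X = to (case4-⟦⟧ no𝟎) x″ in x , λ _ → B⊆X

    impose-imposed : Imposed j B r (value (impose j B r))
    impose-imposed with value (someIn B r isZero) in z
    ... | true = case1-imposed (to (someIn-spec B r isZero) z)
    ... | false with value (someIn B r isIndexed) in ab
    ...   | true = case4-imposed (someIn-none B r isZero z)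
    ...   | false with value (someIn B r isTwo) in t
    ...     | true  = case3-imposed (someIn-none B r isZero z) (someIn-none B r isIndexed ab)
                                  (to (someIn-spec B r isTwo) t)
    ...     | false = case2-imposed (someIn-none B r isZero z) (someIn-none B r isIndexed ab)
                                  (someIn-none B r isTwo t)

  -- Cost of one imposition

  case3-time : ∀ j (B : Subset w) r → time (case3 j B r) ≤ w * 4 + 1
  case3-time j B r = +-mono-≤ (loop-time 3 (case3Body j B) step r) ≤-refl
    where
    step : ∀ p x → time (case3Body j B p x) ≤ 3
    step p x with lookup B p
    ... | false = s≤s z≤n
    ... | true with isTwo (lookup x p)
    ...   | true  = ≤-refl
    ...   | false = s≤s (s≤s z≤n)

  case4-time : ∀ j (B : Subset w) r →
               time (case4 j B r) ≤ (w + w * 4) + ((w + w * 4) + (w * 5 + 1))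
  case4-time j B r = +-mono-≤ (firedIndices-time B r) (+-mono-≤ (keptIndices-time B r)
    (+-mono-≤ (loop-time 4 (case4Body B fired kept) step r) (≤-refl {1})))
    where
    fired = value (firedIndices B r)
    kept  = value (keptIndices B r)

    step : ∀ p x → time (case4Body B fired kept p x) ≤ 4
    step p x with lookup B p
    ... | true = s≤s (s≤s z≤n)
    ... | false with lookup x p
    ...   | 𝟎 = s≤s (s≤s z≤n)
    ...   | 𝟏 = s≤s (s≤s z≤n)
    ...   | 𝟐 = s≤s (s≤s z≤n)
    ...   | a i with lookup kept i
    ...     | true  = s≤s (s≤s (s≤s z≤n))
    ...     | false = ≤-refl
    step p x | false | b i with lookup fired i
    ...     | true  = ≤-refl
    ...     | false = s≤s (s≤s (s≤s z≤n))

  -- The length is added because each resulting row is later pushed at unit cost. Case 4 is the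
  -- dearest branch and supplies the constants: two scans (6w), the copy (w), two arrays of marks
  -- (10w) and the rewriting loop (5w); the 4 stands for two writes and two pushes. The other
  -- branches are padded.
  impose-time : ∀ j (B : Subset w) r →
                time (impose j B r) + length (value (impose j B r)) ≤ w * 22 + 4
  impose-time j B r with value (someIn B r isZero)
  ... | true = begin
    (time (someIn B r isZero) + 1) + 1 ≤⟨ ℕ.+-monoˡ-≤ 1 (ℕ.+-monoˡ-≤ 1 (someIn-time B r isZero)) ⟩
    (w * 3 + 1) + 1                    ≤⟨ ℕ.m≤m+n _ (w * 19 + 2) ⟩
    (w * 3 + 1) + 1 + (w * 19 + 2)     ≡⟨ sum≡ w ⟩
    w * 22 + 4                         ∎
    where
    open ≤-Reasoning
    sum≡ : ∀ n → (n * 3 + 1) + 1 + (n * 19 + 2) ≡ n * 22 + 4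
    sum≡ = solve-∀
  ... | false with value (someIn B r isIndexed)
  ...   | true = ≤-trans
    (ℕ.+-monoˡ-≤ 2 (+-mono-≤ (someIn-time B r isZero) (+-mono-≤ (someIn-time B r isIndexed)
      (+-mono-≤ (≤-refl {w}) (+-mono-≤ (≤-refl {1}) (+-mono-≤ (case4-time j B r) (≤-refl {0})))))))
    (≤-reflexive (sum≡ w))
    where
    sum≡ : ∀ n → n * 3 + (n * 3 + (n + (1 + ((n + n * 4) + ((n + n * 4) + (n * 5 + 1)) + 0)))) + 2
                 ≡ n * 22 + 4
    sum≡ = solve-∀
  ...   | false with value (someIn B r isTwo)
  ...     | true = ≤-trans
    (ℕ.+-monoˡ-≤ 1 (+-mono-≤ (someIn-time B r isZero) (+-mono-≤ (someIn-time B r isIndexed)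
      (+-mono-≤ (someIn-time B r isTwo) (+-mono-≤ (case3-time j B r) (≤-refl {0}))))))
    (≤-trans (ℕ.m≤m+n _ (w * 9 + 2)) (≤-reflexive (sum≡ w)))
    where
    sum≡ : ∀ n → n * 3 + (n * 3 + (n * 3 + (n * 4 + 1 + 0))) + 1 + (n * 9 + 2) ≡ n * 22 + 4
    sum≡ = solve-∀
  ...     | false = ≤-trans
    (ℕ.+-monoˡ-≤ 1 (+-mono-≤ (someIn-time B r isZero) (+-mono-≤ (someIn-time B r isIndexed)
      (+-mono-≤ (someIn-time B r isTwo) (≤-refl {0})))))
    (≤-trans (ℕ.m≤m+n _ (w * 13 + 3)) (≤-reflexive (sum≡ w)))
    where
    sum≡ : ∀ n → n * 3 + (n * 3 + (n * 3 + 0)) + 1 + (n * 13 + 3) ≡ n * 22 + 4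
    sum≡ = solve-∀

  -- Treatment of the working stack

  pushAll-value : ∀ k (rs : List (Row w)) es → value (pushAll k rs es) ≡ map (k ,_) rs ++ es
  pushAll-value k []       es = refl
  pushAll-value k (r ∷ rs) es = cong ((k , r) ∷_) (pushAll-value k rs es)

  pushAll-time : ∀ k (rs : List (Row w)) es → time (pushAll k rs es) ≡ length rs
  pushAll-time k []       es = refl
  pushAll-time k (r ∷ rs) es = trans (ℕ.+-comm _ 1) (cong suc (pushAll-time k rs es))

  -- The lists are joined in reverse since rows finished later lie on top of the final stack.
  IsDisjointUnionOf-++ : ∀ {𝓕 𝓖 : Pred (Subset w) 0ℓ} {rs ss} →
                         IsDisjointUnionOf 𝓕 rs → IsDisjointUnionOf 𝓖 ss →
                         𝓕 ⊥ 𝓖 → IsDisjointUnionOf (𝓕 ∪ 𝓖) (ss ++ rs)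
  IsDisjointUnionOf-++ {rs = rs} {ss} (F , rs-disj) (G , ss-disj) F⊥G =
      (λ X → mk⇔
        [ Any.++⁺ʳ ss ∘ to (F X) , Any.++⁺ˡ ∘ to (G X) ]′
        ([ inj₂ ∘ from (G X) , inj₁ ∘ from (F X) ]′ ∘ Any.++⁻ ss))
    , AllPairs.++⁺ ss-disj rs-disj (All.tabulate λ s∈ → All.tabulate λ r∈ {X} (Xs , Xr) →
        F⊥G (from (F X) (lose r∈ Xr) , from (G X) (lose s∈ Xs)))

  IsDisjointUnionOf-resp : ∀ {𝓕 𝓖 : Pred (Subset w) 0ℓ} {rs} → (∀ {X} → 𝓕 X ⇔ 𝓖 X) →
                           IsDisjointUnionOf 𝓕 rs → IsDisjointUnionOf 𝓖 rs
  IsDisjointUnionOf-resp eqv (F , disj) =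
    (λ X → mk⇔ (to (F X) ∘ from eqv) (to eqv ∘ from (F X))) , disj

  module _ (L : Vec (Subset w) w) where

    -- The bound 22w + 4 on an imposition with its pushes, plus 3 for the pop, the comparison with
    -- `w` and the reading of the lower covers.
    treat-time : ℕ
    treat-time = w * 22 + 7

    treat-last : ∀ {r es fs} → treat L (w , r) (stacks es fs) ≡ stacks es (r ∷ fs) costs 3
    treat-last with w <? w
    ... | yes w<w = contradiction w<w (ℕ.<-irrefl refl)
    ... | no _    = refl

    module _ {k} (k<w : k < w) (r : Row w) where

      imposed : Timed (List (Row w))
      imposed = impose (fromℕ< k<w) (lookup L (fromℕ< k<w)) r

      treat-pending : ∀ {es fs} → treat L (k , r) (stacks es fs) ≡
                      stacks (map (suc k ,_) (value imposed) ++ es) fs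
                        costs (3 + (time imposed + (length (value imposed) + 0)))
      treat-pending {es} with k <? w
      ... | no k≮w = contradiction k<w k≮w
      ... | yes _ rewrite pushAll-value (suc k) (value imposed) es
                        | pushAll-time (suc k) (value imposed) es = refl

    -- `treat` is stuck on a comparison with `w`, so its evaluated form enters through an equation.
    next′ : ∀ {e es fs m F t} → treat L e (stacks es fs) ≡ m → Runs L (value m) F t →
            Runs L (stacks (e ∷ es) fs) F (time m + t)
    next′ refl = next

    -- Treating es, whatever lies below it on the working stack, displays 𝓕 by
    -- rows within n units of time per row.
    record Outcome (n : ℕ) (𝓕 : Pred (Subset w) 0ℓ) (es : List Entry) : Set where
      field
        rows    : List (Row w)
        cost    : ℕ
        runs    : ∀ {es′ fs F t} → Runs L (stacks es′ (rows ++ fs)) F t →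
                  Runs L (stacks (es ++ es′) fs) F (cost + t)
        areRows : All IsRow rows
        display : IsDisjointUnionOf 𝓕 rows
        enough  : length es ≤ length rows
        bound   : cost ≤ n * length rows

    open Outcome

    Outcome-resp : ∀ {n 𝓕 𝓖 es} → (∀ {X} → 𝓕 X ⇔ 𝓖 X) → Outcome n 𝓕 es → Outcome n 𝓖 es
    Outcome-resp eqv o = record { Outcome o ; display = IsDisjointUnionOf-resp eqv (display o) }

    Outcome-[] : ∀ {n} → Outcome n ∅ []
    Outcome-[] = record
      { rows = [] ; cost = 0 ; runs = id ; areRows = [] ; enough = z≤n ; bound = z≤n
      ; display = (λ X → mk⇔ (λ ()) λ ()) , [] }

    -- The entry `e` is finished together with all its descendants before `es` is touched; as `runs`
    -- holds for any remaining stack, the two runs chain. A bound linear in the number of rows adds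
    -- up without loss.
    Outcome-∷ : ∀ {n 𝓕 𝓖 e es} → Outcome n 𝓕 (e ∷ []) → Outcome n 𝓖 es → 𝓕 ⊥ 𝓖 →
           Outcome n (𝓕 ∪ 𝓖) (e ∷ es)
    Outcome-∷ {n} {e = e} {es} o₁ o₂ F⊥G = record
      { rows    = rows o₂ ++ rows o₁
      ; cost    = cost o₁ + cost o₂
      ; runs    = λ {es′} {fs} {F} {t} R →
          subst (Runs L _ F) (sym (ℕ.+-assoc (cost o₁) (cost o₂) t))
            (runs o₁ (runs o₂ (subst (λ ss → Runs L (stacks es′ ss) F t)
              (++-assoc (rows o₂) (rows o₁) fs) R)))
      ; areRows = All.++⁺ (areRows o₂) (areRows o₁)
      ; display = IsDisjointUnionOf-++ (display o₁) (display o₂) F⊥G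
      ; enough  = ≤-trans (+-mono-≤ (enough o₁) (enough o₂)) (≤-reflexive (sym length≡))
      ; bound   = begin
          cost o₁ + cost o₂                             ≤⟨ +-mono-≤ (bound o₁) (bound o₂) ⟩
          n * length (rows o₁) + n * length (rows o₂)   ≡⟨ ℕ.*-distribˡ-+ n _ _ ⟨
          n * (length (rows o₁) + length (rows o₂))     ≡⟨ cong (n *_) length≡ ⟨
          n * length (rows o₂ ++ rows o₁)               ∎
      }
      where
      open ≤-Reasoning
      length≡ : length (rows o₂ ++ rows o₁) ≡ length (rows o₁) + length (rows o₂)
      length≡ = trans (length-++ (rows o₂)) (ℕ.+-comm (length (rows o₂)) _)

    Outcome-map : ∀ {n k 𝓖 rs} → AllPairs (λ r s → ⟦ r ⟧ ⊥ ⟦ s ⟧) rs →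
             All (λ r → Outcome n (⟦ r ⟧ ∩ 𝓖) ((k , r) ∷ [])) rs →
             Outcome n ((λ X → Any (λ r → ⟦ r ⟧ X) rs) ∩ 𝓖) (map (k ,_) rs)
    Outcome-map [] [] = Outcome-resp (mk⇔ (λ ()) λ ()) Outcome-[]
    Outcome-map (r⊥ ∷ disj) (o ∷ os) = Outcome-resp
      (mk⇔ [ (λ (x , g) → here x , g) , (λ (x , g) → there x , g) ]′
           (λ { (here x , g) → inj₁ (x , g) ; (there x , g) → inj₂ (x , g) }))
      (Outcome-∷ o (Outcome-map disj os) λ ((x , _) , (y , _)) →
        All.lookupAny r⊥ y |> λ (s⊥ , y′) → s⊥ (x , y′))

    -- The charging step: at least one final row descends from the entry, so the cost of treating it
    -- is at most `treat-time` per row, and the rate grows by that much.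
    node : ∀ {n k 𝓕 r} (k<w : k < w) → 1 ≤ length (value (imposed k<w r)) →
           Outcome n 𝓕 (map (suc k ,_) (value (imposed k<w r))) →
           Outcome (treat-time + n) 𝓕 ((k , r) ∷ [])
    node {n} {k} {r = r} k<w nonempty o = record
      { Outcome o
      ; cost   = here-cost + cost o
      ; runs   = λ {_} {_} {F} {t} R → subst (Runs L _ F) (sym (ℕ.+-assoc here-cost (cost o) t))
                   (next′ (treat-pending k<w r) (runs o R))
      ; enough = some-row
      ; bound  = begin
          here-cost + cost o
            ≤⟨ +-mono-≤ here-cost≤ (bound o) ⟩
          treat-time + n * length (rows o)
            ≤⟨ ℕ.+-monoˡ-≤ _ (ℕ.m≤m*n treat-time _ ⦃ >-nonZero some-row ⦄) ⟩
          treat-time * length (rows o) + n * length (rows o)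
            ≡⟨ ℕ.*-distribʳ-+ _ treat-time n ⟨
          (treat-time + n) * length (rows o) ∎
      }
      where
      open ≤-Reasoning
      j  = fromℕ< k<w
      rs = value (imposed k<w r)

      here-cost : ℕ
      here-cost = 3 + (time (imposed k<w r) + (length rs + 0))

      here-cost≤ : here-cost ≤ treat-time
      here-cost≤ = begin
        3 + (time (imposed k<w r) + (length rs + 0))
          ≡⟨ cong (λ l → 3 + (time (imposed k<w r) + l)) (ℕ.+-identityʳ _) ⟩
        3 + (time (imposed k<w r) + length rs)
          ≤⟨ ℕ.+-monoʳ-≤ 3 (impose-time j (lookup L j) r) ⟩
        3 + (w * 22 + 4)
          ≡⟨ sum≡ w ⟩
        w * 22 + 7 ∎
        where
        sum≡ : ∀ m → 3 + (m * 22 + 4) ≡ m * 22 + 7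
        sum≡ = solve-∀

      some-row : 1 ≤ length (rows o)
      some-row = ≤-trans nonempty (subst (_≤ length (rows o)) (length-map _ rs) (enough o))

    -- Pending implications

    From : ℕ → Pred (Subset w) 0ℓ
    From k X = ∀ j → k ≤ toℕ j → Implies j (lookup L j) X

    From-suc : ∀ {k j X} → toℕ j ≡ k → From k X ⇔ (Implies j (lookup L j) X × From (suc k) X)
    From-suc {j = j} {X} refl = mk⇔
      (λ f → f j ≤-refl , λ i j<i → f i (ℕ.<⇒≤ j<i))
      (λ (imp , f) i j≤i →
        [ f i , (λ j≡i → subst (λ i → Implies i (lookup L i) X) (toℕ-injective j≡i) imp) ]′
          (ℕ.m≤n⇒m<n∨m≡n j≤i))

    module _ (below : ∀ {j p} → p ∈ lookup L j → p Fin.< j) where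

      -- Induction on the number `d` of pending implications. The path from this entry to a final
      -- row has `suc d` entries, each contributing `treat-time` to the rate.
      outcome : ∀ d k r → d + k ≡ w → Invariant k r →
                Outcome (suc d * treat-time) (⟦ r ⟧ ∩ From k) ((k , r) ∷ [])
      outcome zero k r refl inv = record
        { rows    = r ∷ []
        -- The pop, the comparison with `w` and the push onto the final stack.
        ; cost    = 3
        ; runs    = next′ treat-last
        ; areRows = Invariant⇒IsRow inv ∷ []
        ; display = (λ X → mk⇔ (here ∘ proj₁)
                      λ { (here x) → x , λ j w≤j → contradiction (toℕ<n j) (ℕ.≤⇒≯ w≤j)
                        ; (there ()) })
                  , [] ∷ []
        ; enough  = ≤-refl
        ; bound   = begin
            3                     ≤⟨ ℕ.m≤n+m 3 (k * 22 + 4) ⟩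
            k * 22 + 4 + 3        ≡⟨ sum≡ k ⟩
            (k * 22 + 7 + 0) * 1  ∎
        }
        where
        open ≤-Reasoning
        sum≡ : ∀ m → m * 22 + 4 + 3 ≡ (m * 22 + 7 + 0) * 1
        sum≡ = solve-∀
      outcome (suc d) k r eq inv = Outcome-resp
        (λ {X} → mk⇔
          (λ (x , f) → let x₀ , imp = from (proj₁ represents X) x
                       in x₀ , from (From-suc j≡k) (imp , f))
          (λ (x , f) → let imp , f′ = to (From-suc j≡k) f
                       in to (proj₁ represents X) (x , imp) , f′))
        (node k<w nonempty (Outcome-map (proj₂ represents) (All.map
          (λ {s} → outcome d (suc k) s (trans (ℕ.+-suc d k) eq))
          (subst (λ i → All (Invariant (suc i)) (value (imposed k<w r))) j≡k invariant))))
        where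
        k<w : k < w
        k<w = subst (k <_) eq (s≤s (ℕ.m≤n+m k d))

        j≡k : toℕ (fromℕ< k<w) ≡ k
        j≡k = toℕ-fromℕ< k<w

        open Imposed (Imposing.impose-imposed below (subst (λ i → Invariant i r) (sym j≡k) inv))

  𝟐-invariant : Invariant 0 (replicate w 𝟐)
  𝟐-invariant = record
    { prem-at   = λ {_} {p} eq → contradiction (trans (sym (lookup-replicate p 𝟐)) eq) λ ()
    ; conc⇒prem = λ {_} {p} eq → contradiction (trans (sym (lookup-replicate p 𝟐)) eq) λ ()
    ; prem⇒conc = λ {p} eq → contradiction (trans (sym (lookup-replicate p 𝟐)) eq) λ ()
    ; free      = λ {p} _ → lookup-replicate p 𝟐
    }

  ⟦𝟐⟧-full : ∀ X → ⟦ replicate w 𝟐 ⟧ X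
  ⟦𝟐⟧-full X = from (⟦⟧⇔Allows 𝟐-invariant)
    λ p → subst (Allows X p) (sym (lookup-replicate p 𝟐)) tt

-- Order ideals as the sets closed under lower covers

does-true : ∀ {A : Set} (A? : Dec A) → does A? ≡ true → A
does-true (yes x) _ = x

module _ {w : ℕ} (P : LabelledPoset w) where

  private module P = LabelledPoset P

  ∈LC⇔⋖ : ∀ {j p} → p ∈ P.LC j ⇔ p P.⋖ j
  ∈LC⇔⋖ {j} {p} = mk⇔
    (λ p∈ → does-true (p P.⋖? j) (trans (sym (lookup∘tabulate _ p)) ([]=⇒lookup p∈)))
    (λ p⋖j → lookup⇒[]= p _ (trans (lookup∘tabulate _ p) (dec-true (p P.⋖? j) p⋖j)))

  <⇒Fin< : ∀ {p q} → p P.< q → p Fin.< q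
  <⇒Fin< (p≤q , p≢q) = ℕ.≤∧≢⇒< (P.linearExtension p≤q) (p≢q ∘ toℕ-injective)

  LC-below : ∀ {j p} → p ∈ P.LC j → p Fin.< j
  LC-below = <⇒Fin< ∘ proj₁ ∘ to ∈LC⇔⋖

  -- If q is not covered by p, an intermediate m splits [q, p] into two
  -- intervals whose labels span a shorter range.
  LC-closed⇒<-closed : ∀ {X} → (∀ j → Implies j (P.LC j) X) →
                       ∀ n {p q} → toℕ p ∸ toℕ q < n → q P.< p → p ∈ X → q ∈ X
  LC-closed⇒<-closed {X} closed (suc n) {p} {q} (s≤s range≤n) q<p p∈X
    with any? (λ m → (q P.<ₚ? m) ×-dec (m P.<ₚ? p))
  ... | no none = closed p p∈X (from ∈LC⇔⋖ (q<p , none))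
  ... | yes (m , q<m , m<p) =
    LC-closed⇒<-closed closed n
      (ℕ.<-≤-trans (ℕ.∸-monoˡ-< (<⇒Fin< m<p) (ℕ.<⇒≤ (<⇒Fin< q<m))) range≤n) q<m
      (LC-closed⇒<-closed closed n
        (ℕ.<-≤-trans (ℕ.∸-monoʳ-< (<⇒Fin< q<m) (ℕ.<⇒≤ (<⇒Fin< m<p))) range≤n) m<p p∈X)

  IsOrderIdeal⇔LC-closed : ∀ {X} → P.IsOrderIdeal X ⇔ (∀ j → Implies j (P.LC j) X)
  IsOrderIdeal⇔LC-closed {X} = mk⇔ covers ideal
    where
    covers : P.IsOrderIdeal X → ∀ j → Implies j (P.LC j) X
    covers ideal j j∈X p∈ = ideal j∈X (proj₁ (proj₁ (to ∈LC⇔⋖ p∈)))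

    ideal : (∀ j → Implies j (P.LC j) X) → P.IsOrderIdeal X
    ideal closed {p} {q} p∈X q≤p with q ≟ p
    ... | yes refl = p∈X
    ... | no q≢p   = LC-closed⇒<-closed closed _ ≤-refl (q≤p , q≢p) p∈X

  lookup-table : ∀ j → lookup (tabulate P.LC) j ≡ P.LC j
  lookup-table = lookup∘tabulate P.LC

  table : Vec (Subset w) w
  table = tabulate P.LC

  IsOrderIdeal⇔From : ∀ {X} → P.IsOrderIdeal X ⇔ From table 0 X
  IsOrderIdeal⇔From {X} = mk⇔ respects ideal
    where
    respects : P.IsOrderIdeal X → From table 0 X
    respects X-ideal j _ = subst (λ B → Implies j B X) (sym (lookup-table j))
      (to IsOrderIdeal⇔LC-closed X-ideal j)

    ideal : From table 0 X → P.IsOrderIdeal X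
    ideal f = from IsOrderIdeal⇔LC-closed
      λ j → subst (λ B → Implies j B X) (lookup-table j) (f j z≤n)

  -- The initial row represents every subset, so its members that satisfy all implications are
  -- exactly the ideals.
  ideals : Outcome table (suc w * treat-time table) P.IsOrderIdeal ((0 , replicate w 𝟐) ∷ [])
  ideals = Outcome-resp table
    (λ {X} → mk⇔ (from IsOrderIdeal⇔From ∘ proj₂) λ X-ideal →
      ⟦𝟐⟧-full X , to IsOrderIdeal⇔From X-ideal)
    (outcome table (λ {j} {p} p∈ → LC-below (subst (p ∈_) (lookup-table j) p∈))
      w 0 _ (ℕ.+-identityʳ w) 𝟐-invariant)

-- The summand `w + 1` is the time of `start`, and the 1 next to `t` that of `halt`. For w, R ≥ 1, w
-- + 2 is at most 3Rw², and (w + 1)(22w + 7) is at most 2w · 29w, so the constant is 3 + 58 = 61.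
-- For w = 0 the time is still positive while w² vanishes.
total-time : ∀ w R t → 1 ≤ w → 1 ≤ R → t ≤ suc w * (w * 22 + 7) * R →
             (w + 1) + (t + 1) ≤ 61 * (R * w ^ 2)
total-time w R t 1≤w 1≤R t≤ = begin
  (w + 1) + (t + 1)
    ≡⟨ regroup w t ⟩
  (w + 2) + t
    ≤⟨ +-mono-≤ (+-mono-≤ w≤ (ℕ.*-monoʳ-≤ 2 1≤)) t≤ ⟩
  w * (w * R) + 2 * (w * (w * R)) + suc w * (w * 22 + 7) * R
    ≤⟨ ℕ.+-monoʳ-≤ _ (ℕ.*-monoˡ-≤ R
         (ℕ.*-mono-≤ (ℕ.+-monoˡ-≤ w 1≤w) (ℕ.+-monoʳ-≤ (w * 22) (ℕ.*-monoʳ-≤ 7 1≤w)))) ⟩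
  w * (w * R) + 2 * (w * (w * R)) + (w + w) * (w * 22 + 7 * w) * R
    ≡⟨ collect w R ⟩
  61 * (R * w ^ 2) ∎
  where
  open ≤-Reasoning
  regroup : ∀ w t → (w + 1) + (t + 1) ≡ (w + 2) + t
  regroup = solve-∀
  collect : ∀ w R → w * (w * R) + 2 * (w * (w * R)) + (w + w) * (w * 22 + 7 * w) * R ≡
                    61 * (R * (w * (w * 1)))
  collect = solve-∀
  1≤wR : 1 ≤ w * R
  1≤wR = ℕ.*-mono-≤ 1≤w 1≤R
  1≤ : 1 ≤ w * (w * R)
  1≤ = ℕ.*-mono-≤ 1≤w 1≤wR
  w≤ : w ≤ w * (w * R)
  w≤ = ℕ.m≤m*n w (w * R) ⦃ >-nonZero 1≤wR ⦄

theorem5 : ∃[ C ] ((w : ℕ) (P : LabelledPoset w) →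
    ∃[ F ] ∃[ t ] (ABAlgorithm P F t
    × All IsRow F
    × IsDisjointUnionOf (LabelledPoset.IsOrderIdeal P) F
    × (1 ≤ w → t ≤ C * (length F * w ^ 2))))
theorem5 = 61 , λ w P →
  let open Outcome (ideals P)
      halted = subst (λ F → Runs (table P) (stacks [] F) rows 1) (sym (++-identityʳ rows)) halt
  in rows , (w + 1) + (cost + 1) , run (runs halted) , areRows , display ,
     -- For the single initial entry, `enough` says that R ≥ 1.
     λ 1≤w → total-time w (length rows) cost 1≤w enough bound
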